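{- Let $G$ be the corresponding graph of an array $A$ with reach one and let $F$ be a resulting DFS forest of $G$. Let $H=F$ if all components of $F$ are directed paths; otherwise let $H$ be the graph obtained by merging the sub-trees of $F$. Let $H_1$ and $H_2$ be two distinct components of $H$, and apply the component merge to $H_1$ and $H_2$. Then the resulting graph contains a directed Hamiltonian path of the merged component, i.e. a directed path visiting every vertex of $V(H_1)\cup V(H_2)$ exactly once.
   Context: An array is a finite sequence $A=(A[1],\dots,A[n])$ of pairwise distinct real numbers. The corresponding graph of $A$ with reach one is the directed graph on $\{1,\dots,n\}$ with an arc $(i,j)$ whenever $j\equiv i\pm1\pmod n$, $j\ne i$, and $A[i]<A[j]$. DFS is run with adjacency lists sorted in increasing $A$-value and a visiting list containing all vertices; the resulting DFS forest consists of the arcs $(\mathrm{parent}(w),w)$ along which DFS discovers vertices; components are components of the underlying undirected graph, each a rooted tree. Merging the sub-trees of $F$: for each component of $F$ whose root has exactly two children $a_1,b_1$, set $p=a_1$, $q=b_1$ and, while both are defined: if $A[p]<A[q]$ add the arc $(p,q)$ and replace $p$ by its smallest-valued child in $F$ (undefined if none); otherwise add the arc $(q,p)$ and replace $q$ by its smallest-valued child in $F$ (undefined if none). Component merge of two distinct components $C,D$: set $p,q$ to the minimum-valued vertices of $C,D$; while both are defined: if $A[p]<A[q]$ add the arc $(p,q)$ and replace $p$ by the smallest-valued out-neighbour of $p$ within $C$ (ignoring arcs added during this merge; undefined if none); otherwise add $(q,p)$ and replace $q$ analogously within $D$. -}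

module Defs where

open import Data.Fin using (Fin; toℕ)
open import Data.Fin.Subset using (Subset; Nonempty) renaming (_∈_ to _∈ˢ_)
open import Data.List using (List; []; _∷_; _++_)
open import Data.List.Membership.Propositional using (_∈_; _∉_)
open import Data.List.Relation.Unary.Linked using (Linked)
open import Data.List.Relation.Unary.Unique.Propositional using (Unique)
open import Data.Nat using (ℕ; suc; ∣_-_∣)
open import Data.Nat.Divisibility using (_∣_)
open import Data.Product using (_×_; _,_; ∃-syntax)
open import Data.Sum using (_⊎_)
open import Function.Bundles using (_⇔_)
open import Level using (Level; _⊔_; 0ℓ)
open import Relation.Binary.Bundles using (StrictTotalOrder)
open import Relation.Binary.Construct.Closure.Equivalence using (EqClosure)
open import Relation.Binary.Construct.Union using (_∪_)
open import Relation.Binary.Core using (Rel) renaming (_⇔_ to _≐_)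
open import Relation.Binary.PropositionalEquality using (_≡_; _≢_)
open import Relation.Nullary using (¬_)
open import Relation.Unary using (Pred)

private
  variable
    ℓ : Level
    n : ℕ

-- The standard library has no real numbers; the values are taken from an
-- arbitrary strict total order, since only comparisons of values are used.

record Array {a ℓ₁ ℓ₂ : Level} (O : StrictTotalOrder a ℓ₁ ℓ₂) (n : ℕ)
             : Set (a ⊔ ℓ₁) where
  open StrictTotalOrder O using (Carrier; _≈_)
  field
    value    : Fin n → Carrier
    distinct : ∀ {i j} → i ≢ j → ¬ (value i ≈ value j)

-- A directed graph on {0, …, n-1} is its arc relation.

Digraph : ℕ → (ℓ : Level) → Set (Level.suc ℓ)
Digraph n ℓ = Rel (Fin n) ℓ

arcsOf : List (Fin n × Fin n) → Digraph n 0ℓ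
arcsOf es u v = (u , v) ∈ es

-- C is the vertex set of a component of the underlying undirected graph.

IsComponent : Digraph n ℓ → Subset n → Set ℓ
IsComponent R C =
  Nonempty C × (∀ {u} v → u ∈ˢ C → (v ∈ˢ C) ⇔ EqClosure R u v)

IsHamiltonianPath : Digraph n ℓ → Subset n → List (Fin n) → Set ℓ
IsHamiltonianPath R C vs =
  Linked R vs × Unique vs × (∀ v → (v ∈ vs) ⇔ (v ∈ˢ C))

HasHamiltonianPath : Digraph n ℓ → Subset n → Set ℓ
HasHamiltonianPath R C = ∃[ vs ] IsHamiltonianPath R C vs

Consecutive : List (Fin n) → Fin n → Fin n → Set
Consecutive vs u v = ∃[ xs ] ∃[ ys ] vs ≡ xs ++ u ∷ v ∷ ys

-- The subgraph on C is a directed path: there are no arcs besides those of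
-- the path.

IsDirectedPath : Digraph n ℓ → Subset n → Set ℓ
IsDirectedPath R C = ∃[ vs ]
  IsHamiltonianPath R C vs ×
  (∀ {u v} → u ∈ˢ C → v ∈ˢ C → R u v → Consecutive vs u v)

AllComponentsPaths : Digraph n ℓ → Set ℓ
AllComponentsPaths R = ∀ C → IsComponent R C → IsDirectedPath R C

IsRoot : Digraph n ℓ → Fin n → Set ℓ
IsRoot R r = ∀ u → ¬ R u r

ExactlyTwoChildren : Digraph n ℓ → (r a b : Fin n) → Set ℓ
ExactlyTwoChildren R r a b =
  R r a × R r b × a ≢ b × (∀ c → R r c → c ≡ a ⊎ c ≡ b)

infix 4 _≡_[mod_]

_≡_[mod_] : ℕ → ℕ → ℕ → Set
x ≡ y [mod n ] = n ∣ ∣ x - y ∣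

-- Depth-first search.  A state is the set of visited vertices together with
-- the forest arcs found so far.

record State (n : ℕ) : Set where
  constructor ⟨_,_⟩
  field
    visited : List (Fin n)
    arcs    : List (Fin n × Fin n)

module DFS (adj : Fin n → List (Fin n)) where

  -- Scan u ws s t: scanning the remaining part ws of the adjacency list of u
  -- takes state s to state t.

  data Scan (u : Fin n) : List (Fin n) → State n → State n → Set where
    done     : ∀ {s} → Scan u [] s s
    skip     : ∀ {w ws vis es t} → w ∈ vis →
               Scan u ws ⟨ vis , es ⟩ t →
               Scan u (w ∷ ws) ⟨ vis , es ⟩ t
    discover : ∀ {w ws vis es s t} → w ∉ vis →
               Scan w (adj w) ⟨ w ∷ vis , (u , w) ∷ es ⟩ s →
               Scan u ws s t →
               Scan u (w ∷ ws) ⟨ vis , es ⟩ t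

  -- Processing the visiting list.

  data Visit : List (Fin n) → State n → State n → Set where
    done : ∀ {s} → Visit [] s s
    skip : ∀ {r rs vis es t} → r ∈ vis →
           Visit rs ⟨ vis , es ⟩ t →
           Visit (r ∷ rs) ⟨ vis , es ⟩ t
    root : ∀ {r rs vis es s t} → r ∉ vis →
           Scan r (adj r) ⟨ r ∷ vis , es ⟩ s →
           Visit rs s t →
           Visit (r ∷ rs) ⟨ vis , es ⟩ t

module _ {a ℓ₁ ℓ₂ : Level} {O : StrictTotalOrder a ℓ₁ ℓ₂} {n : ℕ}
         (A : Array O n) where

  Below : Rel (Fin n) ℓ₂
  Below i j = StrictTotalOrder._<_ O (Array.value A i) (Array.value A j)

  -- Congruences modulo n do not depend on whether indices start at 0 or 1.

  ReachOneGraph : Digraph n ℓ₂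
  ReachOneGraph i j =
    (toℕ j ≡ suc (toℕ i) [mod n ] ⊎ suc (toℕ j) ≡ toℕ i [mod n ]) ×
    j ≢ i × Below i j

  record IsDFSForest (F : List (Fin n × Fin n)) : Set ℓ₂ where
    field
      adj            : Fin n → List (Fin n)
      adj-neighbours : ∀ u v → (v ∈ adj u) ⇔ ReachOneGraph u v
      adj-increasing : ∀ u → Linked Below (adj u)
      visitingList   : List (Fin n)
      visitsAll      : ∀ v → v ∈ visitingList
      finallyVisited : List (Fin n)
      run            : DFS.Visit adj visitingList ⟨ [] , [] ⟩
                                                  ⟨ finallyVisited , F ⟩

  IsSmallest : Pred (Fin n) ℓ → Fin n → Set (ℓ ⊔ ℓ₂)
  IsSmallest P v = P v × (∀ w → P w → ¬ Below w v)

  -- The merging loop started at p₀ and q₀, where N₁ p p′ (resp. N₂ q q′)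
  -- means that p (resp. q) is to be replaced by p′ (resp. q′).  If there is
  -- no such successor, the pointer becomes undefined and the loop stops:
  -- Reached p q says that the loop gets to an iteration with both pointers
  -- defined, namely at p and q.

  module Merge {ℓ : Level} (N₁ N₂ : Rel (Fin n) ℓ) (p₀ q₀ : Fin n) where

    data Reached : Fin n → Fin n → Set (ℓ ⊔ ℓ₂) where
      start    : Reached p₀ q₀
      advance₁ : ∀ {p q p′} → Reached p q → Below p q → N₁ p p′ →
                 Reached p′ q
      advance₂ : ∀ {p q q′} → Reached p q → ¬ Below p q → N₂ q q′ →
                 Reached p q′

    data Added : Fin n → Fin n → Set (ℓ ⊔ ℓ₂) where
      forth : ∀ {p q} → Reached p q → Below p q → Added p q
      back  : ∀ {p q} → Reached p q → ¬ Below p q → Added q p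

  -- The roles of the two children a and b may be exchanged: this does not
  -- change the arcs added, because the values are distinct.

  SubtreeArcs : Digraph n ℓ → Digraph n (ℓ ⊔ ℓ₂)
  SubtreeArcs F u v = ∃[ r ] ∃[ a ] ∃[ b ]
    IsRoot F r × ExactlyTwoChildren F r a b ×
    Merge.Added smallestChild smallestChild a b u v
    where
    smallestChild : Rel (Fin n) _
    smallestChild p = IsSmallest (F p)

  MergeSubtrees : Digraph n ℓ → Digraph n (ℓ ⊔ ℓ₂)
  MergeSubtrees F = F ∪ SubtreeArcs F

  -- H is F if all components of F are directed paths, and otherwise the
  -- result of merging the sub-trees of F (equality of arc sets).

  data IsPreprocessed {ℓF ℓH : Level} (F : Digraph n ℓF) (H : Digraph n ℓH)
                      : Set (ℓF ⊔ ℓH ⊔ ℓ₂) where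
    unchanged : AllComponentsPaths F → H ≐ F → IsPreprocessed F H
    merged    : ¬ AllComponentsPaths F → H ≐ MergeSubtrees F →
                IsPreprocessed F H

  ComponentArcs : Digraph n ℓ → (C D : Subset n) → Digraph n (ℓ ⊔ ℓ₂)
  ComponentArcs H C D u v = ∃[ p ] ∃[ q ]
    IsSmallest (_∈ˢ C) p × IsSmallest (_∈ˢ D) q ×
    Merge.Added (smallestIn C) (smallestIn D) p q u v
    where
    smallestIn : Subset n → Rel (Fin n) _
    smallestIn E x = IsSmallest (λ y → (y ∈ˢ E) × H x y)

  MergeComponents : Digraph n ℓ → (C D : Subset n) → Digraph n (ℓ ⊔ ℓ₂)
  MergeComponents H C D = H ∪ ComponentArcs H C D

{-# OPTIONS --safe #-}
module Submission where

-- All arcs increase the value.  Two increasing lists along which the two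
-- pointers of a merging loop move are merged, as sorted lists, into a path:
-- two neighbours in the sorted union lie either on the same list, or are
-- joined by the arc added when the pointers reached them.  In F a vertex has
-- at most one parent, and both its parent and its children are among its at
-- most two neighbours on the cycle.  So only roots branch, into at most two
-- chains, and the loop on the sub-trees turns each component of F into an
-- increasing Hamiltonian path.  The component merge then follows two such paths.

open import Defs
open import Data.Empty using (⊥-elim)
open import Data.Fin using (Fin; toℕ; _≟_)
open import Data.Fin.Induction using (spo-wellFounded; spo-noetherian)
open import Data.Fin.Properties using (any?; toℕ-injective; toℕ<n)
open import Data.Fin.Subset using (Subset; _∪_) renaming (_∈_ to _∈ˢ_)
open import Data.Fin.Subset.Properties using (⊆-antisym; x∈p∪q⁺; x∈p∪q⁻)
open import Data.List using (List; []; _∷_; head; merge)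
import Data.List.Membership.DecPropositional as DecMembership
open import Data.List.Membership.Propositional using (_∈_)
open import Data.List.Membership.Propositional.Properties using (∈-++⁺ˡ; ∈-++⁺ʳ; ∈-++⁻)
open import Data.List.Relation.Binary.Permutation.Propositional using (↭-sym)
open import Data.List.Relation.Binary.Permutation.Propositional.Properties
  using (∈-resp-↭; merge-↭)
open import Data.List.Relation.Unary.All as All using ()
open import Data.List.Relation.Unary.AllPairs as AllPairs using (AllPairs)
open import Data.List.Relation.Unary.Any using (here; there)
open import Data.List.Relation.Unary.Linked as Linked using (Linked; []; [-]; _∷_; _∷′_)
open import Data.List.Relation.Unary.Linked.Properties using (Linked⇒AllPairs)
open import Data.List.Relation.Unary.Unique.Propositional using (Unique)
open import Data.Maybe using (just)
open import Data.Maybe.Relation.Binary.Connected using (Connected; just)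
open import Data.Nat using (ℕ; suc; zero; ∣_-_∣; _<_)
open import Data.Nat.Divisibility using (_∣_; ∣m+n∣m⇒∣n; ∣m∸n∣n⇒∣m; ∣⇒≤)
open import Data.Nat.Properties
  using (≤-total; m≤n⇒∣m-n∣≡n∸m; ∣-∣-comm; m∸n+n≡m; m+[n∸m]≡n; ∣m-n∣≡0⇒m≡n;
         <⇒≱; ∣m-n∣≤m⊔n; ⊔-pres-<m; ≤-<-trans)
open import Data.Product using (_×_; _,_; proj₁; proj₂; ∃; ∃-syntax)
open import Data.Product.Properties using (≡-dec)
open import Data.Sum as Sum using (_⊎_; inj₁; inj₂; [_,_]′)
open import Function using (_∘_; id; flip; Equivalence; mk⇔)
open import Induction.WellFounded using (Acc; acc)
open import Level using (Level; 0ℓ)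
open import Relation.Binary.Bundles using (StrictTotalOrder)
open import Relation.Binary.Construct.Closure.Equivalence as EqC using (EqClosure)
open import Relation.Binary.Construct.Closure.ReflexiveTransitive as Star
  using (Star; ε; _◅_; _◅◅_)
open import Relation.Binary.Construct.Closure.Symmetric using (fwd; bwd)
open import Relation.Binary.Core using (Rel; _⇒_)
open import Relation.Binary.Definitions using (Decidable; tri<; tri≈; tri>)
open import Relation.Binary.PropositionalEquality
  using (_≡_; _≢_; refl; sym; trans; subst; isEquivalence; resp₂)
open import Relation.Binary.Structures using (IsStrictPartialOrder)
open import Relation.Nullary using (¬_; Dec; yes; no; ¬?; _×-dec_)
open import Relation.Nullary.Decidable using (decidable-stable)
open import Relation.Unary using (Pred)

private
  variable
    ℓ ℓ′ : Level
    n : ℕ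

-- Congruences modulo `n` and neighbours on the cycle.

∣-∣-diff : ∀ {d} m n → d ∣ m → d ∣ n → d ∣ ∣ m - n ∣
∣-∣-diff {d} m n d∣m d∣n with ≤-total m n
... | inj₁ m≤n = subst (d ∣_) (sym (m≤n⇒∣m-n∣≡n∸m m≤n))
  (∣m+n∣m⇒∣n (subst (d ∣_) (sym (m+[n∸m]≡n m≤n)) d∣n) d∣m)
... | inj₂ n≤m = subst (d ∣_) (trans (sym (m≤n⇒∣m-n∣≡n∸m n≤m)) (∣-∣-comm n m))
  (∣m+n∣m⇒∣n (subst (d ∣_) (sym (m+[n∸m]≡n n≤m)) d∣m) d∣n)

∣-∣-cancel : ∀ {d} m n → d ∣ ∣ m - n ∣ → d ∣ n → d ∣ m
∣-∣-cancel {d} m n d∣∣m-n∣ d∣n with ≤-total m n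
... | inj₁ m≤n = ∣m+n∣m⇒∣n (subst (d ∣_) (sym (m∸n+n≡m m≤n)) d∣n)
                           (subst (d ∣_) (m≤n⇒∣m-n∣≡n∸m m≤n) d∣∣m-n∣)
... | inj₂ n≤m = ∣m∸n∣n⇒∣m d n≤m
  (subst (d ∣_) (trans (∣-∣-comm m n) (m≤n⇒∣m-n∣≡n∸m n≤m)) d∣∣m-n∣) d∣n

-- Distances are unchanged by removing a common successor, so the recursion stops with one of the
-- three numbers zero; there a distance becomes a plain number and divisibility of sums and
-- differences applies.
≡-mod-euclidean : ∀ {d} x y z → x ≡ z [mod d ] → y ≡ z [mod d ] → x ≡ y [mod d ]
≡-mod-euclidean zero    y       z       p q = ∣-∣-cancel y z q p
≡-mod-euclidean {d} (suc x) zero z      p q = ∣-∣-cancel (suc x) z p q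
≡-mod-euclidean (suc x) (suc y) zero    p q = ∣-∣-diff (suc x) (suc y) p q
≡-mod-euclidean (suc x) (suc y) (suc z) p q = ≡-mod-euclidean x y z p q

-- Two indices differ by less than `n`, and the only multiple of `n` that small is zero.
toℕ-mod-injective : (i j : Fin n) → toℕ i ≡ toℕ j [mod n ] → i ≡ j
toℕ-mod-injective {n} i j n∣ with ∣ toℕ i - toℕ j ∣ in eq
... | zero  = toℕ-injective (∣m-n∣≡0⇒m≡n eq)
... | suc k = ⊥-elim (<⇒≱ (subst (_< n) eq
  (≤-<-trans (∣m-n∣≤m⊔n (toℕ i) (toℕ j)) (⊔-pres-<m (toℕ<n i) (toℕ<n j)))) (∣⇒≤ n∣))

-- The congruence part of `ReachOneGraph`, split off because, unlike the arcs, it is symmetric.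
Adjacent : Rel (Fin n) 0ℓ
Adjacent {n} i j = toℕ j ≡ suc (toℕ i) [mod n ] ⊎ suc (toℕ j) ≡ toℕ i [mod n ]

adjacent-sym : {i j : Fin n} → Adjacent i j → Adjacent j i
adjacent-sym {n} {i} {j} =
  [ inj₂ ∘ subst (n ∣_) (∣-∣-comm (toℕ j) (suc (toℕ i)))
  , inj₁ ∘ subst (n ∣_) (∣-∣-comm (suc (toℕ j)) (toℕ i)) ]′

-- A neighbour is a successor or a predecessor of `i` modulo `n`, and either congruence determines
-- it. Among three neighbours two are of the same kind.
at-most-two-adjacent : {i : Fin n} (j k l : Fin n) →
  Adjacent i j → Adjacent i k → Adjacent i l → j ≡ k ⊎ l ≡ j ⊎ l ≡ k
at-most-two-adjacent {i = i} j k l = cases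
  where
  successor-unique : ∀ x y → toℕ x ≡ suc (toℕ i) [mod _ ] →
                     toℕ y ≡ suc (toℕ i) [mod _ ] → x ≡ y
  successor-unique x y p q =
    toℕ-mod-injective x y (≡-mod-euclidean (toℕ x) (toℕ y) (suc (toℕ i)) p q)
  predecessor-unique : ∀ x y → suc (toℕ x) ≡ toℕ i [mod _ ] →
                       suc (toℕ y) ≡ toℕ i [mod _ ] → x ≡ y
  predecessor-unique x y p q =
    toℕ-mod-injective x y (≡-mod-euclidean (suc (toℕ x)) (suc (toℕ y)) (toℕ i) p q)
  cases : Adjacent i j → Adjacent i k → Adjacent i l → j ≡ k ⊎ l ≡ j ⊎ l ≡ k
  cases (inj₁ p) (inj₁ q) _        = inj₁ (successor-unique j k p q)
  cases (inj₂ p) (inj₂ q) _        = inj₁ (predecessor-unique j k p q)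
  cases (inj₁ p) (inj₂ q) (inj₁ s) = inj₂ (inj₁ (successor-unique l j s p))
  cases (inj₁ p) (inj₂ q) (inj₂ s) = inj₂ (inj₂ (predecessor-unique l k s q))
  cases (inj₂ p) (inj₁ q) (inj₁ s) = inj₂ (inj₂ (successor-unique l k s q))
  cases (inj₂ p) (inj₁ q) (inj₂ s) = inj₂ (inj₁ (predecessor-unique l j s p))

-- Paths and components.

linked⇒star : ∀ {a} {X : Set a} {R : Rel X ℓ} {x xs v} →
  Linked R (x ∷ xs) → v ∈ x ∷ xs → Star R x v
linked⇒star _       (here refl) = ε
linked⇒star (e ∷ l) (there v∈)  = e ◅ linked⇒star l v∈

linked-predecessor : ∀ {a} {X : Set a} {R : Rel X ℓ} {x xs v} →
  Linked R (x ∷ xs) → v ∈ xs → ∃[ u ] (u ∈ x ∷ xs × R u v)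
linked-predecessor (e ∷ _) (here refl) = _ , here refl , e
linked-predecessor (_ ∷ l) (there v∈)  with linked-predecessor l v∈
... | u , u∈ , e = u , there u∈ , e

star⇒eqClosure : {R : Rel (Fin n) ℓ} → Star R ⇒ EqClosure R
star⇒eqClosure = Star.map fwd

component-resp : {R : Digraph n ℓ} {S : Digraph n ℓ′} → R ⇒ S → S ⇒ R →
  {C : Subset n} → IsComponent R C → IsComponent S C
component-resp R⇒S S⇒R (nonempty , connected) = nonempty , λ v u∈ → mk⇔
  (EqC.map R⇒S ∘ Equivalence.to (connected v u∈))
  (Equivalence.from (connected v u∈) ∘ EqC.map S⇒R)

component-⊆ : {R : Digraph n ℓ} {C D : Subset n} → IsComponent R C → IsComponent R D →
  ∀ {v} → v ∈ˢ C → v ∈ˢ D → ∀ {x} → x ∈ˢ C → x ∈ˢ D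
component-⊆ (_ , compC) (_ , compD) v∈C v∈D x∈C =
  Equivalence.from (compD _ v∈D) (Equivalence.to (compC _ v∈C) x∈C)

components-disjoint : {R : Digraph n ℓ} {C D : Subset n} →
  IsComponent R C → IsComponent R D → C ≢ D → ∀ {v} → v ∈ˢ C → ¬ v ∈ˢ D
components-disjoint compC compD C≢D v∈C v∈D = C≢D
  (⊆-antisym (component-⊆ compC compD v∈C v∈D) (component-⊆ compD compC v∈D v∈C))

-- The order of the vertices by value, and sorted lists.

module _ {a ℓ₁ ℓ₂ : Level} {O : StrictTotalOrder a ℓ₁ ℓ₂} {n : ℕ} (A : Array O n) where

  private module O = StrictTotalOrder O

  infix 4 _≺_ _≺?_

  _≺_ : Rel (Fin n) ℓ₂
  _≺_ = Below A

  _≺?_ : Decidable _≺_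
  i ≺? j = Array.value A i O.<? Array.value A j

  ≺-irrefl : ∀ {i} → ¬ i ≺ i
  ≺-irrefl = O.irrefl O.Eq.refl

  ≺-isStrictPartialOrder : IsStrictPartialOrder _≡_ _≺_
  ≺-isStrictPartialOrder = record
    { isEquivalence = isEquivalence
    ; irrefl        = λ { refl → ≺-irrefl }
    ; trans         = O.trans
    ; <-resp-≈      = resp₂ _≺_
    }

  ≺-connex : ∀ {i j} → i ≢ j → ¬ i ≺ j → j ≺ i
  ≺-connex {i} {j} i≢j i⊀j with O.compare (Array.value A i) (Array.value A j)
  ... | tri< i≺j _ _ = ⊥-elim (i⊀j i≺j)
  ... | tri≈ _ i≈j _ = ⊥-elim (Array.distinct A i≢j i≈j)
  ... | tri> _ _ j≺i = j≺i

  ≺-star : ∀ {i j} → Star _≺_ i j → i ≡ j ⊎ i ≺ j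
  ≺-star ε = inj₁ refl
  ≺-star (i≺k ◅ s) with ≺-star s
  ... | inj₁ refl = inj₂ i≺k
  ... | inj₂ k≺j  = inj₂ (O.trans i≺k k≺j)

  increasing⇒sorted : ∀ {vs} → Linked _≺_ vs → AllPairs _≺_ vs
  increasing⇒sorted = Linked⇒AllPairs O.trans

  increasing⇒unique : ∀ {vs} → Linked _≺_ vs → Unique vs
  increasing⇒unique l =
    AllPairs.map (λ { i≺i refl → ≺-irrefl i≺i }) (increasing⇒sorted l)

  head-least : ∀ {v vs w} → Linked _≺_ (v ∷ vs) → w ∈ v ∷ vs → ¬ w ≺ v
  head-least _ (here refl) = ≺-irrefl
  head-least l (there w∈)  = O.asym (All.lookup (AllPairs.head (increasing⇒sorted l)) w∈)

  above-head : ∀ {v vs w} → v ≺ w → w ∈ v ∷ vs → w ∈ vs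
  above-head v≺v (here refl) = ⊥-elim (≺-irrefl v≺v)
  above-head _   (there w∈)  = w∈

  sort-merge : List (Fin n) → List (Fin n) → List (Fin n)
  sort-merge = merge _≺?_

  ∈-merge⁺ : ∀ xs ys {v} → v ∈ xs ⊎ v ∈ ys → v ∈ sort-merge xs ys
  ∈-merge⁺ xs ys =
    ∈-resp-↭ (↭-sym (merge-↭ _≺?_ xs ys)) ∘ [ ∈-++⁺ˡ , ∈-++⁺ʳ xs ]′

  ∈-merge⁻ : ∀ xs ys {v} → v ∈ sort-merge xs ys → v ∈ xs ⊎ v ∈ ys
  ∈-merge⁻ xs ys = ∈-++⁻ xs ∘ ∈-resp-↭ (merge-↭ _≺?_ xs ys)

  -- The first element of a merge is one of the two heads, so arcs to both heads suffice to prepend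
  -- `x`.
  merge-head : {R : Rel (Fin n) ℓ} → ∀ {x} p ps q qs → R x p → R x q →
    Connected R (just x) (head (sort-merge (p ∷ ps) (q ∷ qs)))
  merge-head p ps q qs Rxp Rxq with p ≺? q
  ... | yes _ = just Rxp
  ... | no  _ = just Rxq

  -- The merging loop as a merge of sorted lists.

  module _ {N₁ N₂ : Rel (Fin n) ℓ} {p₀ q₀ : Fin n} where
    open Merge A N₁ N₂ p₀ q₀

    -- `merge` makes the same comparison as the loop, so the heads of the two remaining lists are
    -- always the current pointers. `R` is left general: it is taken to be a graph, to get a path,
    -- and `_≺_`, to get distinct vertices.
    merge-linked : {R : Rel (Fin n) ℓ′} → N₁ ⇒ R → N₂ ⇒ R → Added ⇒ R →
      ∀ p ps q qs → Reached p q → Linked N₁ (p ∷ ps) → Linked N₂ (q ∷ qs) →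
      Linked R (sort-merge (p ∷ ps) (q ∷ qs))
    merge-linked {R = R} N₁⇒R N₂⇒R Added⇒R = go
      where
      go : ∀ p ps q qs → Reached p q → Linked N₁ (p ∷ ps) → Linked N₂ (q ∷ qs) →
           Linked R (sort-merge (p ∷ ps) (q ∷ qs))
      go p ps q qs pq lp lq with p ≺? q
      -- The loop adds its last arc before the pointer becomes undefined; this arc joins the
      -- exhausted list to the rest of the other.
      go p []        q qs pq _        lq | yes p≺q =
        Added⇒R (forth pq p≺q) ∷ Linked.map N₂⇒R lq
      go p (p′ ∷ ps) q qs pq (e ∷ lp) lq | yes p≺q =
        -- Whichever of `p′` and `q` comes next, `p` has an arc to it: the step to its successor, or
        -- the arc just added.
        merge-head p′ ps q qs (N₁⇒R e) (Added⇒R (forth pq p≺q)) ∷′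
        go p′ ps q qs (advance₁ pq p≺q e) lp lq
      go p ps q []        pq lp _        | no p⊀q =
        Added⇒R (back pq p⊀q) ∷ Linked.map N₁⇒R lp
      go p ps q (q′ ∷ qs) pq lp (e ∷ lq) | no p⊀q =
        merge-head p ps q′ qs (Added⇒R (back pq p⊀q)) (N₂⇒R e) ∷′
        go p ps q′ qs (advance₂ pq p⊀q e) lp lq

    reached-reachable : Reached ⇒ λ p q → Star N₁ p₀ p × Star N₂ q₀ q
    reached-reachable start = ε , ε
    reached-reachable (advance₁ pq _ e) with reached-reachable pq
    ... | sp , sq = sp ◅◅ e ◅ ε , sq
    reached-reachable (advance₂ pq _ e) with reached-reachable pq
    ... | sp , sq = sp , sq ◅◅ e ◅ ε

    -- The test failing at `back` yields the reverse inequality only when the two pointers are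
    -- different vertices.
    added-increasing : (∀ {p q} → Reached p q → p ≢ q) → Added ⇒ _≺_
    added-increasing apart (forth _ p≺q) = p≺q
    added-increasing apart (back pq p⊀q) = ≺-connex (apart pq) p⊀q

  -- The component merge of two Hamiltonian paths.

  module _ {H : Digraph n ℓ} (H⇒≺ : H ⇒ _≺_) {P : Pred (Fin n) 0ℓ} where

    SmallestNext : Rel (Fin n) _
    SmallestNext x = IsSmallest A (λ y → P y × H x y)

    -- Arcs increase the value, so every out-neighbour of `u` in `P` lies on the rest of the path,
    -- whose first vertex is the least. Hence a pointer moving to smallest out-neighbours follows
    -- the path.
    path-smallestNext : ∀ {u vs} → Linked H (u ∷ vs) → (∀ {v} → v ∈ vs → P v) →
      (∀ {w} → P w → u ≺ w → w ∈ vs) → Linked SmallestNext (u ∷ vs)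
    path-smallestNext [-] _ _ = [-]
    path-smallestNext {u} {v ∷ vs} (e ∷ l) vs⊆P above =
      ((vs⊆P (here refl) , e) ,
       λ w (Pw , e′) → head-least (Linked.map H⇒≺ l) (above Pw (H⇒≺ e′))) ∷
      path-smallestNext l (vs⊆P ∘ there)
        (λ Pw v≺w → above-head v≺w (above Pw (O.trans (H⇒≺ e) v≺w)))

  -- Puts a Hamiltonian path in the form needed by `merge-linked`: it starts at the initial pointer,
  -- the minimum, because it is increasing, and it is nonempty because the component is.
  hamiltonianPath-uncons : {H : Digraph n ℓ} → H ⇒ _≺_ → {C : Subset n} →
    IsComponent H C → HasHamiltonianPath H C →
    ∃[ p ] ∃[ ps ] IsSmallest A (_∈ˢ C) p ×
      Linked (λ x → IsSmallest A (λ y → y ∈ˢ C × H x y)) (p ∷ ps) ×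
      (∀ v → v ∈ p ∷ ps → v ∈ˢ C) × (∀ v → v ∈ˢ C → v ∈ p ∷ ps)
  hamiltonianPath-uncons H⇒≺ ((c , c∈) , _) ([] , _ , _ , covers)
    with () ← Equivalence.from (covers c) c∈
  hamiltonianPath-uncons H⇒≺ {C} _ (p ∷ ps , l , _ , covers) =
    p , ps , (vs⊆C p (here refl) , λ w w∈ → head-least (Linked.map H⇒≺ l) (C⊆vs w w∈)) ,
    path-smallestNext H⇒≺ l (vs⊆C _ ∘ there) (λ w∈ p≺w → above-head p≺w (C⊆vs _ w∈)) ,
    vs⊆C , C⊆vs
    where
    vs⊆C : ∀ v → v ∈ p ∷ ps → v ∈ˢ C
    vs⊆C v = Equivalence.to (covers v)
    C⊆vs : ∀ v → v ∈ˢ C → v ∈ p ∷ ps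
    C⊆vs v = Equivalence.from (covers v)

  mergeComponents-hamiltonian : {H : Digraph n ℓ} → H ⇒ _≺_ → {C D : Subset n} →
    IsComponent H C → IsComponent H D → C ≢ D →
    HasHamiltonianPath H C → HasHamiltonianPath H D →
    HasHamiltonianPath (MergeComponents A H C D) (C ∪ D)
  mergeComponents-hamiltonian {H = H} H⇒≺ {C} {D} compC compD C≢D hamC hamD
    with hamiltonianPath-uncons H⇒≺ compC hamC | hamiltonianPath-uncons H⇒≺ compD hamD
  ... | p , ps , p-min , lp , ps⊆C , C⊆ps | q , qs , q-min , lq , qs⊆D , D⊆qs =
    sort-merge (p ∷ ps) (q ∷ qs) ,
    merge-linked (inj₁ ∘ next⇒H) (inj₁ ∘ next⇒H)
      (λ e → inj₂ (p , q , p-min , q-min , e)) p ps q qs M.start lp lq ,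
    -- The same list is linked once more, now by `_≺_`: strict increase excludes repetitions.
    increasing⇒unique (merge-linked (H⇒≺ ∘ next⇒H) (H⇒≺ ∘ next⇒H)
      (added-increasing apart) p ps q qs M.start lp lq) ,
    λ v → mk⇔
      (x∈p∪q⁺ ∘ Sum.map (ps⊆C v) (qs⊆D v) ∘ ∈-merge⁻ (p ∷ ps) (q ∷ qs))
      (∈-merge⁺ (p ∷ ps) (q ∷ qs) ∘ Sum.map (C⊆ps v) (D⊆qs v) ∘ x∈p∪q⁻ C D)
    where
    Next : Subset n → Rel (Fin n) _
    Next E x = IsSmallest A (λ y → y ∈ˢ E × H x y)
    module M = Merge A (Next C) (Next D) p q
    next⇒H : ∀ {E} → Next E ⇒ H
    next⇒H ((_ , e) , _) = e
    stays-in : ∀ {E x y} → x ∈ˢ E → Star (Next E) x y → y ∈ˢ E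
    stays-in x∈ ε = x∈
    stays-in x∈ (((y∈ , _) , _) ◅ s) = stays-in y∈ s
    -- Each pointer stays in its own component, and distinct components are disjoint.
    apart : ∀ {x y} → M.Reached x y → x ≢ y
    apart xy refl with reached-reachable xy
    ... | sx , sy = components-disjoint compC compD C≢D
      (stays-in (proj₁ p-min) sx) (stays-in (proj₁ q-min) sy)

  -- Forests in the reach-one graph: only roots branch.

  module Forest (F : Digraph n 0ℓ) (F? : Decidable F)
                (F⇒G : F ⇒ ReachOneGraph A)
                (unique-parent : ∀ {u u′ v} → F u v → F u′ v → u ≡ u′) where

    SmallestChild : Rel (Fin n) _
    SmallestChild p = IsSmallest A (F p)

    F⇒≺ : F ⇒ _≺_
    F⇒≺ = proj₂ ∘ proj₂ ∘ F⇒G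

    F⇒adjacent : F ⇒ Adjacent
    F⇒adjacent = proj₁ ∘ F⇒G

    at-most-two-children : ∀ {r} a b c → F r a → F r b → F r c →
      a ≡ b ⊎ c ≡ a ⊎ c ≡ b
    at-most-two-children a b c fa fb fc =
      at-most-two-adjacent a b c (F⇒adjacent fa) (F⇒adjacent fb) (F⇒adjacent fc)

    -- The parent and two children of `v` are three neighbours of `v` on the cycle, so two of them
    -- coincide. The parent has a smaller value than `v` and the children have larger ones, so it
    -- must be the children.
    only-child : ∀ {u v c d} → F u v → F v c → F v d → c ≡ d
    only-child {u} {c = c} {d} f fc fd
      with at-most-two-adjacent u c d
             (adjacent-sym {i = u} (F⇒adjacent f)) (F⇒adjacent fc) (F⇒adjacent fd)
    ... | inj₁ refl        = ⊥-elim (O.asym (F⇒≺ f) (F⇒≺ fc))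
    ... | inj₂ (inj₁ refl) = ⊥-elim (O.asym (F⇒≺ f) (F⇒≺ fd))
    ... | inj₂ (inj₂ d≡c)  = sym d≡c

    ancestor-root : ∀ v → ∃[ r ] IsRoot F r × Star F r v
    ancestor-root v = climb v (spo-wellFounded ≺-isStrictPartialOrder v)
      where
      climb : ∀ v → Acc _≺_ v → ∃[ r ] IsRoot F r × Star F r v
      climb v (acc rs) with any? (λ u → F? u v)
      ... | no  orphan  = v , (λ u f → orphan (u , f)) , ε
      ... | yes (u , f) with climb u (rs (F⇒≺ f))
      ...   | r , root , s = r , root , s ◅◅ f ◅ ε

    -- The arc `F u v` certifies that `v` is not a root, and so does each later arc for its head; by
    -- `only-child` the descent never branches. The closure property says that the chain exhausts
    -- the sub-tree. Values increase, so the descent ends.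
    chain : ∀ {u v} → F u v → ∃[ ps ] Linked SmallestChild (v ∷ ps) ×
      (∀ {x w} → x ∈ v ∷ ps → F x w → w ∈ ps)
    chain {v = v} f = descend f (spo-noetherian ≺-isStrictPartialOrder v)
      where
      descend : ∀ {u v} → F u v → Acc (flip _≺_) v →
        ∃[ ps ] Linked SmallestChild (v ∷ ps) × (∀ {x w} → x ∈ v ∷ ps → F x w → w ∈ ps)
      descend {v = v} f (acc rs) with any? (F? v)
      ... | no  leaf    = [] , [-] , λ { (here refl) f′ → ⊥-elim (leaf (_ , f′)) }
      ... | yes (w , g) with descend g (rs (F⇒≺ g))
      ...   | ps , l , closed = w ∷ ps ,
              (g , λ w′ g′ w′≺w → ≺-irrefl (subst (_≺ w) (only-child f g′ g) w′≺w)) ∷ l ,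
              λ { (here refl) g′ → here (only-child f g′ g)
                ; (there x∈)  g′ → there (closed x∈ g′) }

    -- The predecessor of `v` on the path is a parent of `v`, hence the only one.
    closed-upwards : ∀ {x xs u v} → Linked F (x ∷ xs) → v ∈ xs → F u v → u ∈ x ∷ xs
    closed-upwards l v∈ f with linked-predecessor l v∈
    ... | w , w∈ , g = subst (_∈ _) (unique-parent g f) w∈

    smallestChild⇒F : SmallestChild ⇒ F
    smallestChild⇒F = proj₁

    -- Since parents are unique, two ancestors of a common vertex are comparable. A path from one
    -- sibling to the other would enter it through its parent `r` and so close a cycle, which
    -- increasing values forbid.
    siblings-subtrees-disjoint : ∀ {r a b v} → F r a → F r b → a ≢ b →
      Star F a v → ¬ Star F b v
    siblings-subtrees-disjoint {r} fa fb a≢b sa sb =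
      [ incomparable fa fb a≢b , incomparable fb fa (a≢b ∘ sym) ]′ (comparable sa sb)
      where
      last-arc : ∀ {x y} → Star F x y → x ≡ y ⊎ ∃[ z ] Star F x z × F z y
      last-arc ε = inj₁ refl
      last-arc (f ◅ s) with last-arc s
      ... | inj₁ refl         = inj₂ (_ , ε , f)
      ... | inj₂ (z , s′ , g) = inj₂ (z , f ◅ s′ , g)
      cycle-free : ∀ {x y} → F x y → ¬ Star F y x
      cycle-free f s with ≺-star (Star.map F⇒≺ s)
      ... | inj₁ refl = ≺-irrefl (F⇒≺ f)
      ... | inj₂ y≺x  = O.asym (F⇒≺ f) y≺x
      incomparable : ∀ {x y} → F r x → F r y → x ≢ y → ¬ Star F x y
      incomparable fx fy x≢y s with last-arc s
      ... | inj₁ x≡y = x≢y x≡y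
      ... | inj₂ (z , s′ , g) with refl ← unique-parent g fy = cycle-free fx s′
      comparable : ∀ {x y z} → Star F x z → Star F y z → Star F x y ⊎ Star F y x
      comparable ε sy = inj₂ sy
      comparable (f ◅ sx) sy with comparable sx sy
      ... | inj₁ s = inj₁ (f ◅ s)
      ... | inj₂ s with last-arc s
      ...   | inj₁ refl = inj₁ (f ◅ ε)
      ...   | inj₂ (z , s′ , g) with refl ← unique-parent g f = inj₂ s′

    -- Merging the sub-trees makes every component Hamiltonian.

    H : Digraph n ℓ₂
    H = MergeSubtrees A F

    subtreeArcs⇒≺ : SubtreeArcs A F ⇒ _≺_
    subtreeArcs⇒≺ (r , a , b , _ , (fa , fb , a≢b , _) , e) = added-increasing apart e
      where
      apart : ∀ {p q} → Merge.Reached A SmallestChild SmallestChild a b p q → p ≢ q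
      apart pq refl with reached-reachable pq
      ... | sa , sb = siblings-subtrees-disjoint fa fb a≢b
        (Star.map smallestChild⇒F sa) (Star.map smallestChild⇒F sb)

    H⇒≺ : H ⇒ _≺_
    H⇒≺ = [ F⇒≺ , subtreeArcs⇒≺ ]′

    -- Both pointers are descendants of `r`, hence joined in `F` through `r`; the added arcs
    -- therefore never connect different trees.
    subtreeArcs⇒connected : SubtreeArcs A F ⇒ EqClosure F
    subtreeArcs⇒connected (r , a , b , _ , (fa , fb , _) , e) = connected e
      where
      open Merge A SmallestChild SmallestChild a b
      join : Reached ⇒ EqClosure F
      join pq with reached-reachable pq
      ... | sa , sb =
        EqC.symmetric F (star⇒eqClosure (fa ◅ Star.map smallestChild⇒F sa)) ◅◅
        star⇒eqClosure (fb ◅ Star.map smallestChild⇒F sb)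
      connected : Added ⇒ EqClosure F
      connected (forth pq _) = join pq
      connected (back pq _)  = EqC.symmetric F (join pq)

    H-connected⇒F-connected : EqClosure H ⇒ EqClosure F
    H-connected⇒F-connected = [ EqC.return , subtreeArcs⇒connected ]′ EqC.⋆

    -- Closure under the arcs of `F` in both directions makes the list contain the whole tree of
    -- `r`.
    RootedPath : Fin n → List (Fin n) → Set _
    RootedPath r vs = Linked H (r ∷ vs) ×
      (∀ {u v} → F u v → u ∈ r ∷ vs → v ∈ r ∷ vs) ×
      (∀ {u v} → F u v → v ∈ r ∷ vs → u ∈ r ∷ vs)

    rootedPath-leaf : ∀ {r} → IsRoot F r → ¬ ∃ (F r) → RootedPath r []
    rootedPath-leaf root leaf = [-] ,
      (λ { f (here refl) → ⊥-elim (leaf (_ , f)) }) ,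
      (λ { f (here refl) → ⊥-elim (root _ f) })

    rootedPath-one : ∀ {r a} → IsRoot F r → F r a → (∀ c → F r c → c ≡ a) →
      ∃ (RootedPath r)
    rootedPath-one {r} {a} root fa only with chain fa
    ... | ps , l , closed = a ∷ ps , Linked.map inj₁ path ,
      (λ { f (here refl) → there (here (only _ f))
         ; f (there u∈)  → there (there (closed u∈ f)) }) ,
      (λ { f (here refl) → ⊥-elim (root _ f)
         ; f (there v∈)  → closed-upwards path v∈ f })
      where
      path : Linked F (r ∷ a ∷ ps)
      path = fa ∷ Linked.map smallestChild⇒F l

    rootedPath-two : ∀ {r a b} → IsRoot F r → ExactlyTwoChildren F r a b →
      ∃ (RootedPath r)
    rootedPath-two {r} {a} {b} root two@(fa , fb , a≢b , only) with chain fa | chain fb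
    ... | ps , lp , p-closed | qs , lq , q-closed =
      sort-merge (a ∷ ps) (b ∷ qs) ,
      -- The merged list begins with `a` or `b`, and both are children of `r`.
      merge-head a ps b qs (inj₁ fa) (inj₁ fb) ∷′
        merge-linked (inj₁ ∘ smallestChild⇒F) (inj₁ ∘ smallestChild⇒F)
          (λ e → inj₂ (r , a , b , root , two , e)) a ps b qs Merge.start lp lq ,
      (λ { f (here refl) → there (∈-merge⁺ (a ∷ ps) (b ∷ qs) (Sum.map here here (only _ f)))
         ; f (there u∈)  → there (∈-merge⁺ (a ∷ ps) (b ∷ qs)
             (Sum.map (λ u∈ → there (p-closed u∈ f)) (λ u∈ → there (q-closed u∈ f))
               (∈-merge⁻ (a ∷ ps) (b ∷ qs) u∈))) }) ,
      (λ { f (here refl) → ⊥-elim (root _ f)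
         ; f (there v∈)  →
             -- Each chain preceded by `r` is a path of `F`, so parents of its vertices are found
             -- there.
             [ (λ v∈ → weaken inj₁ (closed-upwards (fa ∷ Linked.map smallestChild⇒F lp) v∈ f))
             , (λ v∈ → weaken inj₂ (closed-upwards (fb ∷ Linked.map smallestChild⇒F lq) v∈ f))
             ]′ (∈-merge⁻ (a ∷ ps) (b ∷ qs) v∈) })
      where
      weaken : ∀ {xs} → (∀ {v} → v ∈ xs → v ∈ a ∷ ps ⊎ v ∈ b ∷ qs) →
        ∀ {u} → u ∈ r ∷ xs → u ∈ r ∷ sort-merge (a ∷ ps) (b ∷ qs)
      weaken _    (here u≡r) = here u≡r
      weaken into (there u∈) = there (∈-merge⁺ (a ∷ ps) (b ∷ qs) (into u∈))

    other-child? : ∀ r a → Dec (∃[ b ] F r b × b ≢ a)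
    other-child? r a = any? λ b → F? r b ×-dec ¬? (b ≟ a)

    -- The children of `r` are neighbours of `r` on the cycle, so there are none, one or two.
    rootedPath : ∀ {r} → IsRoot F r → ∃ (RootedPath r)
    rootedPath {r} root with any? (F? r)
    ... | no  leaf     = [] , rootedPath-leaf root leaf
    ... | yes (a , fa) with other-child? r a
    ...   | no none = rootedPath-one root fa
              (λ c fc → decidable-stable (c ≟ a) λ c≢a → none (c , fc , c≢a))
    ...   | yes (b , fb , b≢a) = rootedPath-two root
              (fa , fb , b≢a ∘ sym , λ c fc →
                [ (λ a≡b → ⊥-elim (b≢a (sym a≡b))) , id ]′
                  (at-most-two-children a b c fa fb fc))

    mergeSubtrees-hamiltonian : {C : Subset n} → IsComponent H C → HasHamiltonianPath H C
    mergeSubtrees-hamiltonian ((c , c∈) , connected) with ancestor-root c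
    ... | r , root , s with rootedPath root
    ...   | vs , l , down , up = r ∷ vs , l , increasing⇒unique (Linked.map H⇒≺ l) ,
      λ v → mk⇔
        (λ v∈ → Equivalence.from (connected v c∈)
          (EqC.symmetric H (EqC.map inj₁ (star⇒eqClosure s)) ◅◅
           star⇒eqClosure (linked⇒star l v∈)))
        (λ v∈ → closed (star⇒eqClosure s ◅◅
           H-connected⇒F-connected (Equivalence.to (connected v c∈) v∈)) (here refl))
      where
      -- A walk that uses arcs of `F` in either direction never leaves the list: `down` handles the
      -- forward arcs, `up` the backward ones.
      closed : ∀ {u v} → EqClosure F u v → u ∈ r ∷ vs → v ∈ r ∷ vs
      closed ε           u∈ = u∈
      closed (fwd f ◅ t) u∈ = closed t (down f u∈)
      closed (bwd f ◅ t) u∈ = closed t (up f u∈)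

-- Invariants of depth-first search.

module _ {a ℓ₁ ℓ₂ : Level} {O : StrictTotalOrder a ℓ₁ ℓ₂} {n : ℕ} (A : Array O n)
         {adj : Fin n → List (Fin n)}
         (adj⇒G : ∀ {u v} → v ∈ adj u → ReachOneGraph A u v) where

  open DFS adj

  -- `heads-visited` is what carries `unique-parents` through a discovery: a vertex not yet visited
  -- has no incoming forest arc.
  record Invariant (s : State n) : Set ℓ₂ where
    open State s
    field
      arcs⇒G         : arcsOf arcs ⇒ ReachOneGraph A
      heads-visited  : ∀ {u v} → (u , v) ∈ arcs → v ∈ visited
      unique-parents : ∀ {u u′ v} → (u , v) ∈ arcs → (u′ , v) ∈ arcs → u ≡ u′

  open Invariant

  invariant-empty : Invariant ⟨ [] , [] ⟩
  invariant-empty = record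
    { arcs⇒G = λ () ; heads-visited = λ () ; unique-parents = λ () }

  invariant-root : ∀ {r vis es} → Invariant ⟨ vis , es ⟩ → Invariant ⟨ r ∷ vis , es ⟩
  invariant-root I = record
    { arcs⇒G         = arcs⇒G I
    ; heads-visited  = there ∘ heads-visited I
    ; unique-parents = unique-parents I
    }

  invariant-discover : ∀ {u w vis es} → ReachOneGraph A u w → ¬ w ∈ vis →
    Invariant ⟨ vis , es ⟩ → Invariant ⟨ w ∷ vis , (u , w) ∷ es ⟩
  invariant-discover g w∉ I = record
    { arcs⇒G         = λ { (here refl) → g ; (there e) → arcs⇒G I e }
    ; heads-visited  = λ { (here refl) → here refl ; (there e) → there (heads-visited I e) }
    ; unique-parents = λ
      { (here refl) (here refl) → refl
      ; (here refl) (there e)   → ⊥-elim (w∉ (heads-visited I e))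
      ; (there e)   (here refl) → ⊥-elim (w∉ (heads-visited I e))
      ; (there e)   (there e′)  → unique-parents I e e′ }
    }

  -- The hypothesis concerns the unread part `ws` of the list, which shrinks during a scan; a nested
  -- scan starts with a full adjacency list, where `adj⇒G` supplies it.
  scan-invariant : ∀ {u ws s t} → (∀ {w} → w ∈ ws → ReachOneGraph A u w) →
    Scan u ws s t → Invariant s → Invariant t
  scan-invariant ws⇒G done                  I = I
  scan-invariant ws⇒G (skip _ sc)           I = scan-invariant (ws⇒G ∘ there) sc I
  scan-invariant ws⇒G (discover w∉ sc₁ sc₂) I = scan-invariant (ws⇒G ∘ there) sc₂
    (scan-invariant adj⇒G sc₁ (invariant-discover (ws⇒G (here refl)) w∉ I))

  visit-invariant : ∀ {rs s t} → Visit rs s t → Invariant s → Invariant t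
  visit-invariant done          I = I
  visit-invariant (skip _ v)    I = visit-invariant v I
  visit-invariant (root _ sc v) I =
    visit-invariant v (scan-invariant adj⇒G sc (invariant-root I))

theorem10 : ∀ {a ℓ₁ ℓ₂ ℓ : Level} (O : StrictTotalOrder a ℓ₁ ℓ₂) {n : ℕ} (A : Array O n)
    (F : List (Fin n × Fin n)) → IsDFSForest A F →
    (H : Digraph n ℓ) → IsPreprocessed A (arcsOf F) H →
    (C D : Subset n) → IsComponent H C → IsComponent H D → C ≢ D →
    HasHamiltonianPath (MergeComponents A H C D) (C ∪ D)
theorem10 O {n} A F forest H preprocessed C D compC compD C≢D = conclude preprocessed
  where
  open IsDFSForest forest
  -- Membership in the finite list of arcs is decidable, as the searches for parents and children
  -- require.
  open DecMembership (≡-dec (_≟_ {n}) (_≟_ {n})) using (_∈?_)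
  F-invariant : Invariant A (λ {u v} → Equivalence.to (adj-neighbours u v)) _
  F-invariant = visit-invariant A _ run (invariant-empty A _)
  open Forest A (arcsOf F) (λ u v → (u , v) ∈? F)
    (Invariant.arcs⇒G F-invariant) (Invariant.unique-parents F-invariant)
    using (F⇒≺; H⇒≺; mergeSubtrees-hamiltonian)

  hamiltonian-resp : ∀ {ℓ₃ ℓ₄} {R : Digraph n ℓ₃} {S : Digraph n ℓ₄} → R ⇒ S →
    ∀ {E} → HasHamiltonianPath R E → HasHamiltonianPath S E
  hamiltonian-resp R⇒S (vs , l , rest) = vs , Linked.map R⇒S l , rest

  conclude : IsPreprocessed A (arcsOf F) H →
    HasHamiltonianPath (MergeComponents A H C D) (C ∪ D)
  -- A directed path is in particular a Hamiltonian path of its component, and `H` has the arcs and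
  -- components of `F`.
  conclude (unchanged paths (H⇒F , F⇒H)) =
    mergeComponents-hamiltonian A (F⇒≺ ∘ H⇒F) compC compD C≢D (path compC) (path compD)
    where
    path : ∀ {E} → IsComponent H E → HasHamiltonianPath H E
    path comp with paths _ (component-resp H⇒F F⇒H comp)
    ... | vs , ham , _ = hamiltonian-resp F⇒H (vs , ham)
  conclude (merged _ (H⇒M , M⇒H)) =
    mergeComponents-hamiltonian A (H⇒≺ ∘ H⇒M) compC compD C≢D (path compC) (path compD)
    where
    path : ∀ {E} → IsComponent H E → HasHamiltonianPath H E
    path comp = hamiltonian-resp M⇒H
      (mergeSubtrees-hamiltonian (component-resp H⇒M M⇒H comp))
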